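{- Let $d\ge 1$ be an integer, let $P\subseteq \mathbb R\times[d]$, and let $\mathcal C_{\equiv}(P)$ be as in the context. For any finite family $\mathcal C\subseteq \mathcal C_{\equiv}(P)$, the nerve of $\mathcal C$ is $(2d-1)$-collapsible.
   Context: $[d]=\{1,\dots,d\}$. A (separated) $d$-interval is a set $I=\bigcup_{i\in[d]}\{(x,i)\in\mathbb R\times[d]: x\in I^{(i)}\}$, where each $I^{(i)}\subseteq\mathbb R$ is a convex set (possibly empty), called the $i$-th level of $I$. For $P\subseteq\mathbb R\times[d]$, $\mathcal C_{\equiv}(P)=\{I\cap P: I\subseteq\mathbb R\times[d]\text{ is a } d\text{ -interval}\}$. For a family $\mathcal F=(C_i)_{i\in I}$ of sets indexed by a finite set $I$, its nerve is the abstract simplicial complex $K(\mathcal F)=\{J\subseteq I: \bigcap_{j\in J}C_j\neq\emptyset\}$. The dimension of a face $\alpha$ is $|\alpha|-1$. A face $\sigma$ of a simplicial complex $K$ is free if it is contained in a unique inclusion-maximal face of $K$. An elementary $d$-collapse removes from $K$ a free face $\sigma$ with $\dim\sigma\le d-1$ together with all faces containing it, giving $\mathrm{coll}(K,\sigma)=K\setminus\{\tau\in K:\sigma\subseteq\tau\}$. $K$ is $d$-collapsible if it can be reduced to the empty complex by a sequence of elementary $d$-collapses. -}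

module Defs where

open import Algebra.Bundles using (CommutativeMonoid)
import Algebra.Properties.CommutativeSemigroup as SemigroupProperties
import Algebra.Properties.Group as GroupProperties
import Algebra.Properties.Ring as RingProperties
open import Level using (0ℓ; suc)
open import Data.Nat.Base as ℕ using (ℕ)
import Data.Nat.Properties as ℕₚ
open import Data.Integer.Base as ℤ using (ℤ)
open import Data.Rational.Base as ℚ using (ℚ; 0ℚ; 1ℚ; ½)
import Data.Rational.Properties as ℚₚ
open import Data.Fin.Base using (Fin)
open import Data.Fin.Subset using (Subset; ∣_∣) renaming (_⊆_ to _⊆ˢ_; _∈_ to _∈ˢ_)
import Data.Fin.Subset.Properties as Subsetₚ
open import Data.Product using (∃; ∃!; _×_; _,_; proj₁; proj₂)
open import Data.Product.Relation.Binary.Pointwise.NonDependent using (Pointwise)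
open import Function.Base using (_∘_)
open import Relation.Binary.Core using (Rel)
open import Relation.Binary.Definitions using (_Respects_)
open import Relation.Binary.PropositionalEquality
  using (_≡_; sym; trans; cong; cong₂; subst; module ≡-Reasoning)
open import Relation.Nullary.Negation.Core using (¬_)
open import Relation.Unary using (Pred; _∈_; _∩_; _≐_; ⋂; Satisfiable; Empty)

------------------------------------------------------------------------
-- Real numbers: Cauchy sequences of rationals, as a setoid under _≃_.

Eventually : Pred ℕ 0ℓ → Set
Eventually Q = ∃ λ N → ∀ n → N ℕ.≤ n → Q n

IsCauchy : (ℕ → ℚ) → Set
IsCauchy s = ∀ ε → 0ℚ ℚ.< ε →
  ∃ λ N → ∀ m n → N ℕ.≤ m → N ℕ.≤ n → ℚ.∣ s m ℚ.- s n ∣ ℚ.< ε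

record ℝ : Set where
  constructor mkℝ
  field
    seq      : ℕ → ℚ
    isCauchy : IsCauchy seq

open ℝ public

infix  4 _≃_ _≤ᴿ_
infixl 6 _+ᴿ_ _-ᴿ_
infixl 7 _*ᴿ_
infix  8 -ᴿ_

_≃_ : Rel ℝ 0ℓ
x ≃ y = ∀ ε → 0ℚ ℚ.< ε → Eventually (λ n → ℚ.∣ seq x n ℚ.- seq y n ∣ ℚ.< ε)

_≤ᴿ_ : Rel ℝ 0ℓ
x ≤ᴿ y = ∀ ε → 0ℚ ℚ.< ε → Eventually (λ n → seq x n ℚ.< seq y n ℚ.+ ε)

module _ where
  open GroupProperties ℚₚ.+-0-group using (//-rightDividesˡ)
  open RingProperties ℚₚ.+-*-ring using (x[y-z]≈xy-xz)
  open SemigroupProperties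
    (CommutativeMonoid.commutativeSemigroup ℚₚ.+-0-commutativeMonoid) using (interchange)

  -- Without abstract, checking later uses of ℝ unfolds these proofs and
  -- does not finish in reasonable time.
  abstract
    insert : ∀ a b → a ≡ (a ℚ.- b) ℚ.+ b
    insert a b = sym (//-rightDividesˡ b a)
    neg-diff : ∀ a b → ℚ.- (a ℚ.- b) ≡ ℚ.- a ℚ.- (ℚ.- b)
    neg-diff a b = ℚₚ.neg-distrib-+ a (ℚ.- b)
    sum-diff : ∀ a b c d → a ℚ.+ b ℚ.- (c ℚ.+ d) ≡ (a ℚ.- c) ℚ.+ (b ℚ.- d)
    sum-diff a b c d = trans (cong (a ℚ.+ b ℚ.+_) (ℚₚ.neg-distrib-+ c d)) (interchange a b (ℚ.- c) (ℚ.- d))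
    prod-diff : ∀ a b c d → a ℚ.* b ℚ.- c ℚ.* d ≡ a ℚ.* (b ℚ.- d) ℚ.+ d ℚ.* (a ℚ.- c)
    prod-diff a b c d = begin
      a ℚ.* b ℚ.- c ℚ.* d
        ≡⟨ cong (ℚ._- c ℚ.* d) (insert (a ℚ.* b) (a ℚ.* d)) ⟩
      (a ℚ.* b ℚ.- a ℚ.* d) ℚ.+ a ℚ.* d ℚ.- c ℚ.* d
        ≡⟨ ℚₚ.+-assoc (a ℚ.* b ℚ.- a ℚ.* d) (a ℚ.* d) (ℚ.- (c ℚ.* d)) ⟩
      (a ℚ.* b ℚ.- a ℚ.* d) ℚ.+ (a ℚ.* d ℚ.- c ℚ.* d)
        ≡⟨ cong₂ (λ x y → (a ℚ.* b ℚ.- a ℚ.* d) ℚ.+ (x ℚ.- y)) (ℚₚ.*-comm a d) (ℚₚ.*-comm c d) ⟩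
      (a ℚ.* b ℚ.- a ℚ.* d) ℚ.+ (d ℚ.* a ℚ.- d ℚ.* c)
        ≡⟨ cong₂ ℚ._+_ (sym (x[y-z]≈xy-xz a b d)) (sym (x[y-z]≈xy-xz d a c)) ⟩
      a ℚ.* (b ℚ.- d) ℚ.+ d ℚ.* (a ℚ.- c) ∎
      where open ≡-Reasoning

    half-pos : ∀ {ε} → 0ℚ ℚ.< ε → 0ℚ ℚ.< ½ ℚ.* ε
    half-pos {ε} 0<ε = subst (ℚ._< ½ ℚ.* ε) (ℚₚ.*-zeroʳ ½) (ℚₚ.*-monoʳ-<-pos ½ 0<ε)

    half+half : ∀ ε → ½ ℚ.* ε ℚ.+ ½ ℚ.* ε ≡ ε
    half+half ε = trans (sym (ℚₚ.*-distribʳ-+ ε ½ ½)) (ℚₚ.*-identityˡ ε)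

    const-cauchy : ∀ q → IsCauchy (λ _ → q)
    const-cauchy q ε 0<ε = 0 , λ _ _ _ _ →
      subst (λ p → ℚ.∣ p ∣ ℚ.< ε) (sym (ℚₚ.+-inverseʳ q)) 0<ε

    neg-cauchy : ∀ {s} → IsCauchy s → IsCauchy (λ n → ℚ.- s n)
    neg-cauchy {s} cs ε 0<ε with cs ε 0<ε
    ... | N , close = N , λ m n N≤m N≤n → subst (ℚ._< ε) (eq (s m) (s n)) (close m n N≤m N≤n)
      where
      eq : ∀ a b → ℚ.∣ a ℚ.- b ∣ ≡ ℚ.∣ ℚ.- a ℚ.- (ℚ.- b) ∣
      eq a b = trans (sym (ℚₚ.∣-p∣≡∣p∣ (a ℚ.- b)))
        (cong ℚ.∣_∣ (neg-diff a b))

    add-cauchy : ∀ {s t} → IsCauchy s → IsCauchy t → IsCauchy (λ n → s n ℚ.+ t n)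
    add-cauchy {s} {t} cs ct ε 0<ε with cs (½ ℚ.* ε) (half-pos 0<ε) | ct (½ ℚ.* ε) (half-pos 0<ε)
    ... | N , sClose | M , tClose = N ℕ.⊔ M , λ m n le le′ →
      let open ℚₚ.≤-Reasoning in begin-strict
        ℚ.∣ s m ℚ.+ t m ℚ.- (s n ℚ.+ t n) ∣
          ≡⟨ cong ℚ.∣_∣ (sum-diff (s m) (t m) (s n) (t n)) ⟩
        ℚ.∣ (s m ℚ.- s n) ℚ.+ (t m ℚ.- t n) ∣
          ≤⟨ ℚₚ.∣p+q∣≤∣p∣+∣q∣ (s m ℚ.- s n) (t m ℚ.- t n) ⟩
        ℚ.∣ s m ℚ.- s n ∣ ℚ.+ ℚ.∣ t m ℚ.- t n ∣
          <⟨ ℚₚ.+-mono-<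
               (sClose m n (ℕₚ.m⊔n≤o⇒m≤o N M le) (ℕₚ.m⊔n≤o⇒m≤o N M le′))
               (tClose m n (ℕₚ.m⊔n≤o⇒n≤o N M le) (ℕₚ.m⊔n≤o⇒n≤o N M le′)) ⟩
        ½ ℚ.* ε ℚ.+ ½ ℚ.* ε
          ≡⟨ half+half ε ⟩
        ε ∎

    cauchy-bounded : ∀ {s} → IsCauchy s →
      ∃ λ B → 0ℚ ℚ.< B × Eventually (λ n → ℚ.∣ s n ∣ ℚ.≤ B)
    cauchy-bounded {s} cs with cs 1ℚ (ℚₚ.positive⁻¹ 1ℚ)
    ... | N , close = 1ℚ ℚ.+ ℚ.∣ s N ∣
      , ℚₚ.+-mono-<-≤ (ℚₚ.positive⁻¹ 1ℚ) (ℚₚ.0≤∣p∣ (s N))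
      , N , λ n N≤n → let open ℚₚ.≤-Reasoning in begin
          ℚ.∣ s n ∣
            ≡⟨ cong ℚ.∣_∣ (insert (s n) (s N)) ⟩
          ℚ.∣ (s n ℚ.- s N) ℚ.+ s N ∣
            ≤⟨ ℚₚ.∣p+q∣≤∣p∣+∣q∣ (s n ℚ.- s N) (s N) ⟩
          ℚ.∣ s n ℚ.- s N ∣ ℚ.+ ℚ.∣ s N ∣
            ≤⟨ ℚₚ.+-monoˡ-≤ ℚ.∣ s N ∣ (ℚₚ.<⇒≤ (close n N N≤n ℕₚ.≤-refl)) ⟩
          1ℚ ℚ.+ ℚ.∣ s N ∣ ∎

    divide-pos : ∀ {B η} → 0ℚ ℚ.< B → 0ℚ ℚ.< η → ∃ λ δ → 0ℚ ℚ.< δ × B ℚ.* δ ≡ η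
    divide-pos {B} {η} 0<B 0<η = 1/B ℚ.* η
      , subst (ℚ._< 1/B ℚ.* η) (ℚₚ.*-zeroʳ 1/B) (ℚₚ.*-monoʳ-<-pos 1/B 0<η)
      , trans (sym (ℚₚ.*-assoc B 1/B η))
          (trans (cong (ℚ._* η) (ℚₚ.*-inverseʳ B)) (ℚₚ.*-identityˡ η))
      where
      instance
        B-pos : ℚ.Positive B
        B-pos = ℚ.positive 0<B
        B-nonZero : ℚ.NonZero B
        B-nonZero = ℚₚ.pos⇒nonZero B
      1/B : ℚ
      1/B = ℚ.1/ B
      instance
        1/B-pos : ℚ.Positive 1/B
        1/B-pos = ℚₚ.1/pos⇒pos B

    ∣pq∣≤ : ∀ {p q a b} → 0ℚ ℚ.< a → ℚ.∣ p ∣ ℚ.≤ a → ℚ.∣ q ∣ ℚ.≤ b → ℚ.∣ p ℚ.* q ∣ ℚ.≤ a ℚ.* b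
    ∣pq∣≤ {p} {q} {a} {b} 0<a p≤a q≤b = let open ℚₚ.≤-Reasoning in begin
      ℚ.∣ p ℚ.* q ∣
        ≡⟨ ℚₚ.∣p*q∣≡∣p∣*∣q∣ p q ⟩
      ℚ.∣ p ∣ ℚ.* ℚ.∣ q ∣
        ≤⟨ ℚₚ.*-monoʳ-≤-nonNeg ℚ.∣ q ∣ {{ℚ.nonNegative (ℚₚ.0≤∣p∣ q)}} p≤a ⟩
      a ℚ.* ℚ.∣ q ∣
        ≤⟨ ℚₚ.*-monoˡ-≤-nonNeg a {{ℚ.nonNegative (ℚₚ.<⇒≤ 0<a)}} q≤b ⟩
      a ℚ.* b ∎

    mul-cauchy : ∀ {s t} → IsCauchy s → IsCauchy t → IsCauchy (λ n → s n ℚ.* t n)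
    mul-cauchy {s} {t} cs ct ε 0<ε
      with cauchy-bounded cs | cauchy-bounded ct
    ... | A , 0<A , N₁ , s≤A | B , 0<B , N₂ , t≤B
      with divide-pos 0<A (half-pos (half-pos 0<ε)) | divide-pos 0<B (half-pos (half-pos 0<ε))
    ... | α , 0<α , Aα≡ | β , 0<β , Bβ≡
      with ct α 0<α | cs β 0<β
    ... | N₃ , tClose | N₄ , sClose = N , λ m n le le′ →
      let open ℚₚ.≤-Reasoning in begin-strict
        ℚ.∣ s m ℚ.* t m ℚ.- s n ℚ.* t n ∣
          ≡⟨ cong ℚ.∣_∣ (prod-diff (s m) (t m) (s n) (t n)) ⟩
        ℚ.∣ s m ℚ.* (t m ℚ.- t n) ℚ.+ t n ℚ.* (s m ℚ.- s n) ∣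
          ≤⟨ ℚₚ.∣p+q∣≤∣p∣+∣q∣ (s m ℚ.* (t m ℚ.- t n)) (t n ℚ.* (s m ℚ.- s n)) ⟩
        ℚ.∣ s m ℚ.* (t m ℚ.- t n) ∣ ℚ.+ ℚ.∣ t n ℚ.* (s m ℚ.- s n) ∣
          ≤⟨ ℚₚ.+-mono-≤
               (∣pq∣≤ {s m} {t m ℚ.- t n} 0<A (s≤A m (N₁≤ le))
                 (ℚₚ.<⇒≤ (tClose m n (N₃≤ le) (N₃≤ le′))))
               (∣pq∣≤ {t n} {s m ℚ.- s n} 0<B (t≤B n (N₂≤ le′))
                 (ℚₚ.<⇒≤ (sClose m n (N₄≤ le) (N₄≤ le′)))) ⟩
        A ℚ.* α ℚ.+ B ℚ.* β
          ≡⟨ cong₂ ℚ._+_ Aα≡ Bβ≡ ⟩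
        ½ ℚ.* (½ ℚ.* ε) ℚ.+ ½ ℚ.* (½ ℚ.* ε)
          ≡⟨ half+half (½ ℚ.* ε) ⟩
        ½ ℚ.* ε
          <⟨ ℚₚ.*-monoˡ-<-pos ε {{ℚ.positive 0<ε}} {½} {1ℚ} (ℚ.*<* (ℤ.+<+ ℕₚ.≤-refl)) ⟩
        1ℚ ℚ.* ε
          ≡⟨ ℚₚ.*-identityˡ ε ⟩
        ε ∎
      where
      N : ℕ
      N = (N₁ ℕ.⊔ N₂) ℕ.⊔ (N₃ ℕ.⊔ N₄)
      N₁≤ : ∀ {n} → N ℕ.≤ n → N₁ ℕ.≤ n
      N₁≤ = ℕₚ.m⊔n≤o⇒m≤o N₁ N₂ ∘ ℕₚ.m⊔n≤o⇒m≤o (N₁ ℕ.⊔ N₂) (N₃ ℕ.⊔ N₄)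
      N₂≤ : ∀ {n} → N ℕ.≤ n → N₂ ℕ.≤ n
      N₂≤ = ℕₚ.m⊔n≤o⇒n≤o N₁ N₂ ∘ ℕₚ.m⊔n≤o⇒m≤o (N₁ ℕ.⊔ N₂) (N₃ ℕ.⊔ N₄)
      N₃≤ : ∀ {n} → N ℕ.≤ n → N₃ ℕ.≤ n
      N₃≤ = ℕₚ.m⊔n≤o⇒m≤o N₃ N₄ ∘ ℕₚ.m⊔n≤o⇒n≤o (N₁ ℕ.⊔ N₂) (N₃ ℕ.⊔ N₄)
      N₄≤ : ∀ {n} → N ℕ.≤ n → N₄ ℕ.≤ n
      N₄≤ = ℕₚ.m⊔n≤o⇒n≤o N₃ N₄ ∘ ℕₚ.m⊔n≤o⇒n≤o (N₁ ℕ.⊔ N₂) (N₃ ℕ.⊔ N₄)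

fromℚ : ℚ → ℝ
fromℚ q = mkℝ (λ _ → q) (const-cauchy q)

0ᴿ 1ᴿ : ℝ
0ᴿ = fromℚ 0ℚ
1ᴿ = fromℚ 1ℚ

_+ᴿ_ _*ᴿ_ : ℝ → ℝ → ℝ
x +ᴿ y = mkℝ (λ n → seq x n ℚ.+ seq y n) (add-cauchy {seq x} {seq y} (isCauchy x) (isCauchy y))
x *ᴿ y = mkℝ (λ n → seq x n ℚ.* seq y n) (mul-cauchy {seq x} {seq y} (isCauchy x) (isCauchy y))

-ᴿ_ : ℝ → ℝ
-ᴿ_ x = mkℝ (λ n → ℚ.- seq x n) (neg-cauchy {seq x} (isCauchy x))

_-ᴿ_ : ℝ → ℝ → ℝ
x -ᴿ y = x +ᴿ (-ᴿ y)

------------------------------------------------------------------------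
-- Separated d-intervals.  Since ℝ is a setoid, a subset is a predicate
-- that respects the equality of points.

Convex : Pred (Pred ℝ 0ℓ) 0ℓ
Convex S = ∀ {x y t} → x ∈ S → y ∈ S → 0ᴿ ≤ᴿ t → t ≤ᴿ 1ᴿ →
  (t *ᴿ x +ᴿ (1ᴿ -ᴿ t) *ᴿ y) ∈ S

Point : ℕ → Set
Point d = ℝ × Fin d

_≋_ : ∀ {d} → Rel (Point d) 0ℓ
_≋_ = Pointwise _≃_ _≡_

record IsDInterval {d : ℕ} (I : Pred (Point d) 0ℓ) : Set₁ where
  field
    level        : Fin d → Pred ℝ 0ℓ
    level-resp   : ∀ i → level i Respects _≃_
    level-convex : ∀ i → Convex (level i)
    decomposes   : I ≐ λ (x , i) → x ∈ level i

𝒞≡ : ∀ {d} → Pred (Point d) 0ℓ → Pred (Pred (Point d) 0ℓ) (suc 0ℓ)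
𝒞≡ P C = ∃ λ I → IsDInterval I × C ≐ (I ∩ P)

------------------------------------------------------------------------
-- Finite abstract simplicial complexes.  The empty simplex may be a
-- face, so the complex without faces differs from the one whose only
-- face is the empty simplex.

record Complex (n : ℕ) : Set₁ where
  field
    Face        : Pred (Subset n) 0ℓ
    down-closed : ∀ {σ τ} → σ ⊆ˢ τ → Face τ → Face σ

open Complex public

dim : ∀ {n} → Subset n → ℤ
dim σ = ℤ.+ ∣ σ ∣ ℤ.- ℤ.1ℤ

module _ {n : ℕ} where

  IsMaximalFace : Complex n → Pred (Subset n) 0ℓ
  IsMaximalFace K τ = Face K τ × (∀ {ρ} → Face K ρ → τ ⊆ˢ ρ → τ ≡ ρ)

  IsFree : Complex n → Pred (Subset n) 0ℓ
  IsFree K σ = Face K σ × ∃! _≡_ (λ τ → IsMaximalFace K τ × σ ⊆ˢ τ)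

  coll : Complex n → Subset n → Complex n
  coll K σ = record
    { Face        = λ τ → Face K τ × ¬ (σ ⊆ˢ τ)
    ; down-closed = λ ρ⊆τ (τ∈K , σ⊈τ) →
        down-closed K ρ⊆τ τ∈K , λ σ⊆ρ → σ⊈τ (Subsetₚ.⊆-trans σ⊆ρ ρ⊆τ)
    }

  data Collapsible (k : ℕ) (K : Complex n) : Set where
    empty    : Empty (Face K) → Collapsible k K
    collapse : ∀ σ → IsFree K σ → dim σ ℤ.≤ ℤ.+ k ℤ.- ℤ.1ℤ →
               Collapsible k (coll K σ) → Collapsible k K

-- The intersection over J = ∅ is the whole of A.

nerve : ∀ {n} {A : Set} → (Fin n → Pred A 0ℓ) → Complex n
nerve C = record
  { Face        = λ J → Satisfiable (⋂ (∃ (_∈ˢ J)) (C ∘ proj₁))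
  ; down-closed = λ σ⊆τ (x , x∈⋂) → x , λ (j , j∈σ) → x∈⋂ (j , σ⊆τ j∈σ)
  }

{-# OPTIONS --safe #-}

-- Order the points of the nerve by level and then from left to right, and let
-- k(τ) be the first point common to all sets in τ.  Every earlier point on the
-- level of k(τ) is excluded by the set in τ that starts last on this level; by
-- Helly's theorem on the line, every point on an earlier level is excluded by
-- the set that starts last or by the set that ends first on that level.  These
-- at most 2d - 1 extremal sets (ties broken by the index) form a subface M(τ).
-- The faces with a given M form an interval [M, T] of the face poset, and M is
-- free once all faces of larger grade have been removed, where the grade sums
-- the index of k(τ) and the extremal ranks.

module Submission where

open import Defs
open import Level using (0ℓ)
open import Axiom.ExcludedMiddle using (ExcludedMiddle)
import Data.Bool.Properties as Boolₚ
open import Data.Fin.Base as Fin using (Fin; zero; suc; toℕ; combine; remQuot; fromℕ<)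
import Data.Fin.Properties as Finₚ
open import Data.Fin.Subset using (Subset; inside; outside; ∣_∣; _⊆_; _∪_; ⁅_⁆; ⊥) renaming (_∈_ to _∈ˢ_)
open import Data.Fin.Subset.Properties
  using (⊆-antisym; nonempty?; Empty-unique; ∣⊥∣≡0; ∣⁅x⁆∣≡1; x∈⁅x⁆; p⊆q⇒∣p∣≤∣q∣; p⊂q⇒∣p∣<∣q∣;
         _∈?_; ∉⊥; x∈p∪q⁻; p⊆p∪q; q⊆p∪q)
open import Data.Integer.Base as ℤ using ()
import Data.Integer.Properties as ℤₚ
open import Data.List.Base using (List; []; _∷_; _++_; map; filter; length; lookup)
open import Data.List.Membership.Propositional using (lose) renaming (_∈_ to _∈ᴸ_)
open import Data.List.Membership.Propositional.Properties
  using (∈-map⁺; ∈-++⁺ˡ; ∈-++⁺ʳ; ∈-filter⁺)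
open import Data.List.Properties using (filter-notAll)
open import Data.List.Relation.Binary.Permutation.Propositional using (↭-sym)
open import Data.List.Relation.Binary.Permutation.Propositional.Properties using (∈-resp-↭)
open import Data.List.Relation.Unary.Any using (here; there; index)
open import Data.List.Relation.Unary.Any.Properties using (lookup-index)
open import Data.List.Relation.Unary.Sorted.TotalOrder.Properties using (lookup-mono-≤)
import Data.List.Sort as Sort
open import Data.Nat.Base as ℕ using (ℕ; zero; suc; _+_; _*_; _∸_; _≤_; _<_; _⊔_; z≤n; s≤s)
import Data.Nat.Properties as ℕₚ
open import Data.Product using (∃; _×_; _,_; proj₁; proj₂; swap)
open import Data.Rational.Base as ℚ using (ℚ; 0ℚ; 1ℚ; ½)
import Data.Rational.Properties as ℚₚ
open import Data.Rational.Solver using (module +-*-Solver)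
open import Data.Sum.Base using (_⊎_; inj₁; inj₂)
open import Data.Vec.Base using ([]; _∷_; tabulate; here; there)
open import Data.Vec.Properties using (lookup⇒[]=; []=⇒lookup; lookup∘tabulate; ≡-dec)
open import Function.Base using (_∘_; case_of_)
open import Function.Definitions using (Injective)
open import Relation.Binary.Bundles using (DecTotalOrder)
open import Relation.Binary.Definitions using (_Respects_)
open import Relation.Binary.PropositionalEquality
open import Relation.Nullary using (¬_; Dec; yes; no; does; contradiction; ¬?)
open import Relation.Nullary.Decidable using (dec-true; decidable-stable)
open import Relation.Unary using (Pred; _∈_)

private variable n : ℕ

-- Subsets of a finite set, suprema, sums and cardinalities.

subsets : ∀ n → List (Subset n)
subsets zero    = [] ∷ []
subsets (suc n) = map (outside ∷_) (subsets n) ++ map (inside ∷_) (subsets n)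

∈-subsets : (τ : Subset n) → τ ∈ᴸ subsets n
∈-subsets []            = here refl
∈-subsets (outside ∷ τ) = ∈-++⁺ˡ (∈-map⁺ (outside ∷_) (∈-subsets τ))
∈-subsets (inside  ∷ τ) = ∈-++⁺ʳ _ (∈-map⁺ (inside ∷_) (∈-subsets τ))

_≟ˢ_ : (σ τ : Subset n) → Dec (σ ≡ τ)
_≟ˢ_ = ≡-dec Boolₚ._≟_

-- The least strict upper bound: 1 + max f, and 0 on the empty set.
sup : (Fin n → ℕ) → Subset n → ℕ
sup f []            = 0
sup f (outside ∷ τ) = sup (f ∘ suc) τ
sup f (inside  ∷ τ) = suc (f zero) ⊔ sup (f ∘ suc) τ

<sup : ∀ (f : Fin n → ℕ) {τ v} → v ∈ˢ τ → f v < sup f τ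
<sup f {inside  ∷ τ} here        = ℕₚ.m≤m⊔n (suc (f zero)) (sup (f ∘ suc) τ)
<sup f {inside  ∷ τ} (there v∈τ) = ℕₚ.≤-trans (<sup (f ∘ suc) v∈τ) (ℕₚ.m≤n⊔m (suc (f zero)) _)
<sup f {outside ∷ τ} (there v∈τ) = <sup (f ∘ suc) v∈τ

sup-attained : ∀ (f : Fin n → ℕ) τ → sup f τ ≡ 0 ⊎ (∃ λ v → v ∈ˢ τ × sup f τ ≡ suc (f v))
sup-attained f [] = inj₁ refl
sup-attained f (outside ∷ τ) with sup-attained (f ∘ suc) τ
... | inj₁ eq             = inj₁ eq
... | inj₂ (v , v∈τ , eq) = inj₂ (suc v , there v∈τ , eq)
sup-attained f (inside ∷ τ) with sup-attained (f ∘ suc) τ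
... | inj₁ eq rewrite eq = inj₂ (zero , here , refl)
... | inj₂ (v , v∈τ , eq) rewrite eq with ℕₚ.⊔-sel (f zero) (f (suc v))
...   | inj₁ ⊔≡ = inj₂ (zero , here , cong suc ⊔≡)
...   | inj₂ ⊔≡ = inj₂ (suc v , there v∈τ , cong suc ⊔≡)

sup-attained⁺ : ∀ (f : Fin n → ℕ) {τ u} → u ∈ˢ τ → ∃ λ v → v ∈ˢ τ × sup f τ ≡ suc (f v)
sup-attained⁺ f {τ} u∈τ with sup-attained f τ
... | inj₁ eq = contradiction (subst (_ <_) eq (<sup f u∈τ)) λ ()
... | inj₂ w  = w

sup-lub : ∀ (f : Fin n → ℕ) {τ b} → (∀ {v} → v ∈ˢ τ → f v < b) → sup f τ ≤ b
sup-lub f {τ} below with sup-attained f τ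
... | inj₁ eq             = subst (_≤ _) (sym eq) z≤n
... | inj₂ (v , v∈τ , eq) = subst (_≤ _) (sym eq) (below v∈τ)

sup-mono : ∀ (f : Fin n → ℕ) {σ τ} → σ ⊆ τ → sup f σ ≤ sup f τ
sup-mono f σ⊆τ = sup-lub f (<sup f ∘ σ⊆τ)

∑ : ℕ → (ℕ → ℕ) → ℕ
∑ zero    g = 0
∑ (suc c) g = ∑ c g + g c

∑-mono : ∀ {c c′ g h} → c ≤ c′ → (∀ {t} → t < c → g t ≤ h t) → ∑ c g ≤ ∑ c′ h
∑-mono {zero}             _     _  = z≤n
∑-mono {suc c} {suc c′} {g} {h} c≤c′ le with suc c ℕₚ.≟ suc c′
... | yes refl = ℕₚ.+-mono-≤ (∑-mono ℕₚ.≤-refl (le ∘ ℕₚ.m≤n⇒m≤1+n)) (le ℕₚ.≤-refl)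
... | no  c≢c′ = ℕₚ.≤-trans (∑-mono (ℕₚ.≤-pred (ℕₚ.≤∧≢⇒< c≤c′ c≢c′)) le) (ℕₚ.m≤m+n _ _)

-- Provides the alternative behind `graded`: either the sum of the suprema grows, or each single
-- supremum is unchanged.
∑-strict : ∀ c {g h} → (∀ {t} → t < c → g t ≤ h t) →
  ∑ c g < ∑ c h ⊎ (∀ {t} → t < c → g t ≡ h t)
∑-strict zero    le = inj₂ λ ()
∑-strict (suc c) {g} {h} le with ∑-strict c (le ∘ ℕₚ.m≤n⇒m≤1+n) | g c ℕₚ.≟ h c
... | inj₁ lt | _       = inj₁ (ℕₚ.+-mono-<-≤ lt (le ℕₚ.≤-refl))
... | inj₂ eq | no  c≢  = inj₁ (ℕₚ.+-mono-≤-< (∑-mono {c} ℕₚ.≤-refl (ℕₚ.≤-reflexive ∘ eq))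
                                 (ℕₚ.≤∧≢⇒< (le ℕₚ.≤-refl) c≢))
... | inj₂ eq | yes c≡ = inj₂ λ {t} t<1+c → case ℕₚ.m≤n⇒m<n∨m≡n (ℕₚ.≤-pred t<1+c) of λ where
  (inj₁ t<c)  → eq t<c
  (inj₂ refl) → c≡

∣unique∣≤1 : (p : Subset n) → (∀ {x y} → x ∈ˢ p → y ∈ˢ p → x ≡ y) → ∣ p ∣ ≤ 1
∣unique∣≤1 {n} p unique with nonempty? p
... | no  p≡∅       = subst (λ q → ∣ q ∣ ≤ 1) (sym (Empty-unique p≡∅)) (subst (_≤ 1) (sym (∣⊥∣≡0 n)) z≤n)
... | yes (x , x∈p) = subst (∣ p ∣ ≤_) (∣⁅x⁆∣≡1 x)
  (p⊆q⇒∣p∣≤∣q∣ λ y∈p → subst (_∈ˢ ⁅ x ⁆) (unique x∈p y∈p) (x∈⁅x⁆ x))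

∣p∪q∣≤∣p∣+∣q∣ : (p q : Subset n) → ∣ p ∪ q ∣ ≤ ∣ p ∣ + ∣ q ∣
∣p∪q∣≤∣p∣+∣q∣ []            []            = z≤n
∣p∪q∣≤∣p∣+∣q∣ (outside ∷ p) (outside ∷ q) = ∣p∪q∣≤∣p∣+∣q∣ p q
∣p∪q∣≤∣p∣+∣q∣ (outside ∷ p) (inside  ∷ q) =
  subst (suc ∣ p ∪ q ∣ ≤_) (sym (ℕₚ.+-suc ∣ p ∣ ∣ q ∣)) (s≤s (∣p∪q∣≤∣p∣+∣q∣ p q))
∣p∪q∣≤∣p∣+∣q∣ (inside  ∷ p) (outside ∷ q) = s≤s (∣p∪q∣≤∣p∣+∣q∣ p q)
∣p∪q∣≤∣p∣+∣q∣ (inside  ∷ p) (inside  ∷ q) =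
  s≤s (ℕₚ.≤-trans (∣p∪q∣≤∣p∣+∣q∣ p q) (ℕₚ.+-monoʳ-≤ ∣ p ∣ (ℕₚ.n≤1+n ∣ q ∣)))

-- A proper inclusion the other way round would contradict the cardinalities.
chain-≤⇒⊆ : (p q : Subset n) → p ⊆ q ⊎ q ⊆ p → ∣ p ∣ ≤ ∣ q ∣ → p ⊆ q
chain-≤⇒⊆ p q (inj₁ p⊆q) _     = p⊆q
chain-≤⇒⊆ p q (inj₂ q⊆p) ∣p∣≤∣q∣ {x} x∈p with x ∈? q
... | yes x∈q = x∈q
... | no  x∉q = contradiction (p⊂q⇒∣p∣<∣q∣ (q⊆p , x , x∈p , x∉q)) (ℕₚ.≤⇒≯ ∣p∣≤∣q∣)

-- Collapsing along a foliation of the face poset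

module Classical (em : ExcludedMiddle 0ℓ) where

  ⟪_⟫ : Pred (Fin n) 0ℓ → Subset n
  ⟪ Q ⟫ = tabulate λ x → does (em {Q x})

  ∈⟪⟫⁺ : ∀ {Q : Pred (Fin n) 0ℓ} {x} → Q x → x ∈ˢ ⟪ Q ⟫
  ∈⟪⟫⁺ {Q = Q} {x} q = lookup⇒[]= x _ (trans (lookup∘tabulate _ x) (dec-true em q))

  ∈⟪⟫⁻ : ∀ {Q : Pred (Fin n) 0ℓ} {x} → x ∈ˢ ⟪ Q ⟫ → Q x
  ∈⟪⟫⁻ {Q = Q} {x} x∈ with em {Q x} | trans (sym (lookup∘tabulate (λ x → does (em {Q x})) x)) ([]=⇒lookup x∈)
  ... | yes q | _ = q
  ... | no  _ | ()

  least : ∀ {N} (Q : Pred (Fin N) 0ℓ) → ∃ Q → ∃ λ k → Q k × (∀ {j} → Q j → k Fin.≤ j)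
  least {suc N} Q (k , q) with em {Q zero}
  ... | yes q₀ = zero , q₀ , λ _ → z≤n
  ... | no ¬q₀ with k
  ...   | zero   = contradiction q ¬q₀
  ...   | suc k′ with least (Q ∘ suc) (k′ , q)
  ...     | l , ql , below = suc l , ql , λ { {zero} q₀ → contradiction q₀ ¬q₀ ; {suc j} qj → s≤s (below qj) }

  argmax : ∀ {A : Set} (κ : A → ℕ) (Q : Pred A 0ℓ) xs →
    (∀ {x} → Q x → ¬ x ∈ᴸ xs) ⊎ (∃ λ x → Q x × x ∈ᴸ xs × (∀ {y} → Q y → y ∈ᴸ xs → κ y ≤ κ x))
  argmax κ Q []       = inj₁ λ _ ()
  argmax κ Q (x ∷ xs) with argmax κ Q xs | em {Q x}
  ... | inj₁ none | no ¬q = inj₁ λ { q (here refl) → ¬q q ; q (there ∈xs) → none q ∈xs }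
  ... | inj₁ none | yes q = inj₂ (x , q , here refl , λ
    { _ (here refl) → ℕₚ.≤-refl ; q (there ∈xs) → contradiction ∈xs (none q) })
  ... | inj₂ (m , qm , m∈ , max) | no ¬q = inj₂ (m , qm , there m∈ , λ
    { q (here refl) → contradiction q ¬q ; q (there ∈xs) → max q ∈xs })
  ... | inj₂ (m , qm , m∈ , max) | yes q with ℕₚ.≤-total (κ m) (κ x)
  ...   | inj₁ κm≤κx = inj₂ (x , q , here refl , λ
    { _ (here refl) → ℕₚ.≤-refl ; q (there ∈xs) → ℕₚ.≤-trans (max q ∈xs) κm≤κx })
  ...   | inj₂ κx≤κm = inj₂ (m , qm , there m∈ , λ
    { _ (here refl) → κx≤κm ; q (there ∈xs) → max q ∈xs })

  -- The leaves, i.e. the fibres of M, are the intervals [M τ, T].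
  record IsFoliation (D : ℕ) (M : Subset n → Subset n) (κ : Subset n → ℕ) (K : Complex n) : Set where
    field
      bottom-⊆     : ∀ {τ} → Face K τ → M τ ⊆ τ
      bottom-small : ∀ {τ} → Face K τ → ∣ M τ ∣ ≤ D
      graded       : ∀ {τ ρ} → Face K τ → Face K ρ → M τ ⊆ ρ → κ τ < κ ρ ⊎ M ρ ≡ M τ
      top          : ∀ {τ} → Face K τ → ∃ λ T →
                     Face K T × M T ≡ M τ × (∀ {ρ} → Face K ρ → M ρ ≡ M τ → ρ ⊆ T)

  module _ {D : ℕ} {M : Subset n → Subset n} {κ : Subset n → ℕ} where
    open IsFoliation

    module _ {K : Complex n} (F : IsFoliation D M κ K)
             {τ} (τ∈K : Face K τ) (τ-max : ∀ {ρ} → Face K ρ → κ ρ ≤ κ τ) where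

      private
        -- Maximality of `κ τ` rules out the increasing alternative of `graded`.
        same-leaf : ∀ {ρ} → Face K ρ → M τ ⊆ ρ → M ρ ≡ M τ
        same-leaf ρ∈K σ⊆ρ with graded F τ∈K ρ∈K σ⊆ρ
        ... | inj₁ κτ<κρ = contradiction (τ-max ρ∈K) (ℕₚ.<⇒≱ κτ<κρ)
        ... | inj₂ eq    = eq

      -- By `same-leaf` every face containing `M τ` lies on the leaf of `τ`, hence below its top
      -- `T`. So `T` is maximal, and it is the only maximal face above `M τ`.
      bottom-free : IsFree K (M τ)
      bottom-free with top F τ∈K
      ... | T , T∈K , MT≡ , ⊆T = down-closed K (bottom-⊆ F τ∈K) τ∈K , T
        , ((T∈K , λ ρ∈K T⊆ρ → ⊆-antisym T⊆ρ (⊆T ρ∈K (same-leaf ρ∈K (T⊆ρ ∘ σ⊆T)))) , σ⊆T)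
        , λ ((ρ∈K , ρ-max) , σ⊆ρ) → sym (ρ-max T∈K (⊆T ρ∈K (same-leaf ρ∈K σ⊆ρ)))
        where
        σ⊆T : M τ ⊆ T
        σ⊆T = subst (_⊆ T) MT≡ (bottom-⊆ F T∈K)

      -- The collapse removes one whole leaf and keeps the tops of the others: if the top `T` of the
      -- leaf of `ρ` contained `M τ`, then `M ρ`, `M T` and `M τ` would agree, so `ρ` would contain
      -- `M τ` and would have been removed.
      coll-foliation : IsFoliation D M κ (coll K (M τ))
      coll-foliation .bottom-⊆     (ρ∈K , _) = bottom-⊆ F ρ∈K
      coll-foliation .bottom-small (ρ∈K , _) = bottom-small F ρ∈K
      coll-foliation .graded (ρ∈K , _) (π∈K , _) = graded F ρ∈K π∈K
      coll-foliation .top {ρ} (ρ∈K , σ⊈ρ) with top F ρ∈K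
      ... | T , T∈K , MT≡ , ⊆T = T
        , (T∈K , λ σ⊆T → σ⊈ρ (subst (_⊆ ρ) (trans (sym MT≡) (same-leaf T∈K σ⊆T)) (bottom-⊆ F ρ∈K)))
        , MT≡ , λ (π∈K , _) → ⊆T π∈K

    private
      -- The list `xs` has to contain all faces but may contain other sets. Each collapse removes at
      -- least `τ`, so filtering out `τ` alone shortens the list; `ℓ` bounds its length and drives
      -- the recursion.
      collapsible-within : ∀ ℓ (xs : List (Subset n)) → length xs < ℓ → (K : Complex n) →
        IsFoliation D M κ K → (∀ {τ} → Face K τ → τ ∈ᴸ xs) → Collapsible D K
      collapsible-within (suc ℓ) xs len K F K⊆xs with argmax κ (Face K) xs
      ... | inj₁ none = empty λ τ τ∈K → none τ∈K (K⊆xs τ∈K)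
      ... | inj₂ (τ , τ∈K , τ∈xs , τ-max) =
        collapse (M τ) (bottom-free F τ∈K τ-max′)
          (ℤₚ.+-monoˡ-≤ (ℤ.- ℤ.1ℤ) (ℤ.+≤+ (bottom-small F τ∈K)))
          (collapsible-within ℓ (filter (λ ρ → ¬? (ρ ≟ˢ τ)) xs)
            (ℕₚ.<-≤-trans (filter-notAll _ xs (lose τ∈xs (λ ρ≢τ → ρ≢τ refl))) (ℕₚ.≤-pred len))
            (coll K (M τ)) (coll-foliation F τ∈K τ-max′)
            (λ (ρ∈K , σ⊈ρ) → ∈-filter⁺ _ (K⊆xs ρ∈K)
              λ ρ≡τ → σ⊈ρ (subst (M τ ⊆_) (sym ρ≡τ) (bottom-⊆ F τ∈K))))
        where
        τ-max′ : ∀ {ρ} → Face K ρ → κ ρ ≤ κ τ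
        τ-max′ ρ∈K = τ-max ρ∈K (K⊆xs ρ∈K)

    foliation⇒collapsible : {K : Complex n} → IsFoliation D M κ K → Collapsible D K
    foliation⇒collapsible F = collapsible-within _ (subsets n) ℕₚ.≤-refl _ F (λ {τ} _ → ∈-subsets τ)

  -- The points are numbered by Fin N, and only the scores f t with t < c k matter
  -- at the point k.
  module Staged
    {n N : ℕ} (k₀ : Fin N) (Q : Fin N → Pred (Fin n) 0ℓ)
    (c : Fin N → ℕ) (c-mono : ∀ {j k} → j Fin.≤ k → c j ≤ c k)
    (f : ℕ → Fin n → ℕ) (f-injective : ∀ t → Injective _≡_ _≡_ (f t))
    (exclusion : ∀ {j k u} → j Fin.< k → Q k u → ¬ Q j u →
       ∃ λ t → t < c k × (∀ {v} → Q k v → f t u ≤ f t v → ¬ Q j v))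
    where

    Common : Subset n → Pred (Fin N) 0ℓ
    Common τ k = ∀ {v} → v ∈ˢ τ → Q k v

    first : Subset n → Fin N
    first τ with em {∃ (Common τ)}
    ... | yes e = proj₁ (least (Common τ) e)
    -- The default is reached only if `τ` has no common point, which `common` excludes for faces.
    ... | no  _ = k₀

    first-common : ∀ {τ k} → Common τ k → Common τ (first τ)
    first-common {τ} {k} p with em {∃ (Common τ)}
    ... | yes e = proj₁ (proj₂ (least (Common τ) e))
    ... | no ¬e = contradiction (k , λ {v} → p {v}) ¬e

    first-least : ∀ {τ k} → Common τ k → first τ Fin.≤ k
    first-least {τ} {k} p with em {∃ (Common τ)}
    ... | yes e = proj₂ (proj₂ (least (Common τ) e)) (λ {v} → p {v})
    ... | no ¬e = contradiction (k , λ {v} → p {v}) ¬e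

    -- The extremal element is kept as a set: it has at most one element since `f t` is injective,
    -- and it is empty if `τ` is.
    peak : ℕ → Subset n → Subset n
    peak t τ = ⟪ (λ v → v ∈ˢ τ × sup (f t) τ ≡ suc (f t v)) ⟫

    peaks : ℕ → Subset n → Subset n
    peaks zero    τ = ⊥
    peaks (suc b) τ = peaks b τ ∪ peak b τ

    bottom : Subset n → Subset n
    bottom τ = peaks (c (first τ)) τ

    -- A plain sum can replace a lexicographic comparison, because no summand decreases on passing
    -- from a face `τ` to a face that contains `bottom τ`.
    grade : Subset n → ℕ
    grade τ = toℕ (first τ) + ∑ (c (first τ)) (λ t → sup (f t) τ)

    peaks-⊆ : ∀ b {τ} → peaks b τ ⊆ τ
    peaks-⊆ zero    v∈ = contradiction v∈ ∉⊥
    peaks-⊆ (suc b) {τ} v∈ with x∈p∪q⁻ (peaks b τ) _ v∈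
    ... | inj₁ v∈peaks = peaks-⊆ b v∈peaks
    ... | inj₂ v∈peak  = proj₁ (∈⟪⟫⁻ v∈peak)

    peak-⊆-peaks : ∀ {t b τ} → t < b → peak t τ ⊆ peaks b τ
    peak-⊆-peaks {t} {suc b} {τ} t<1+b v∈ with ℕₚ.m≤n⇒m<n∨m≡n (ℕₚ.≤-pred t<1+b)
    ... | inj₁ t<b  = p⊆p∪q (peak b τ) (peak-⊆-peaks {τ = τ} t<b v∈)
    ... | inj₂ refl = q⊆p∪q (peaks b τ) _ v∈

    ∣peaks∣≤ : ∀ b τ → ∣ peaks b τ ∣ ≤ b
    ∣peaks∣≤ zero    τ = ℕₚ.≤-reflexive (∣⊥∣≡0 n)
    ∣peaks∣≤ (suc b) τ = begin
      ∣ peaks b τ ∪ peak b τ ∣       ≤⟨ ∣p∪q∣≤∣p∣+∣q∣ (peaks b τ) (peak b τ) ⟩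
      ∣ peaks b τ ∣ + ∣ peak b τ ∣   ≤⟨ ℕₚ.+-mono-≤ (∣peaks∣≤ b τ) (∣unique∣≤1 (peak b τ) λ x∈ y∈ →
        f-injective b (ℕₚ.suc-injective (trans (sym (proj₂ (∈⟪⟫⁻ x∈))) (proj₂ (∈⟪⟫⁻ y∈))))) ⟩
      b + 1                          ≡⟨ ℕₚ.+-comm b 1 ⟩
      suc b                          ∎
      where open ℕₚ.≤-Reasoning

    sup-peak : ∀ {t τ ρ} → peak t τ ⊆ ρ → sup (f t) τ ≤ sup (f t) ρ
    sup-peak {t} {τ} {ρ} peak⊆ρ with sup-attained (f t) τ
    ... | inj₁ eq             = subst (_≤ _) (sym eq) z≤n
    ... | inj₂ (v , v∈τ , eq) = subst (_≤ _) (sym eq) (<sup (f t) (peak⊆ρ (∈⟪⟫⁺ (v∈τ , eq))))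

    -- Equal suprema give the maximal elements of `τ` and `ρ` equal scores, so injectivity
    -- identifies them.
    peak-≡ : ∀ {t τ ρ} → peak t τ ⊆ ρ → sup (f t) τ ≡ sup (f t) ρ → peak t ρ ≡ peak t τ
    peak-≡ {t} {τ} {ρ} peak⊆ρ sup≡ = ⊆-antisym
      (λ v∈ → let v∈ρ , eq = ∈⟪⟫⁻ v∈ in case sup-attained (f t) τ of λ where
        (inj₁ 0≡)             → contradiction (trans (sym eq) (trans (sym sup≡) 0≡)) λ ()
        (inj₂ (w , w∈τ , eq′)) → subst (_∈ˢ peak t τ)
          (f-injective t (ℕₚ.suc-injective (trans (sym eq′) (trans sup≡ eq)))) (∈⟪⟫⁺ (w∈τ , eq′)))
      (λ v∈ → ∈⟪⟫⁺ (peak⊆ρ v∈ , trans (sym sup≡) (proj₂ (∈⟪⟫⁻ v∈))))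

    peaks-≡ : ∀ b {τ ρ} → peaks b τ ⊆ ρ → (∀ {t} → t < b → sup (f t) τ ≡ sup (f t) ρ) →
      peaks b ρ ≡ peaks b τ
    peaks-≡ zero    _      _    = refl
    peaks-≡ (suc b) {τ} peaks⊆ρ sup≡ = cong₂ _∪_
      (peaks-≡ b (peaks⊆ρ ∘ p⊆p∪q (peak b τ)) (sup≡ ∘ ℕₚ.m≤n⇒m≤1+n))
      (peak-≡ (peaks⊆ρ ∘ q⊆p∪q (peaks b τ) _) (sup≡ ℕₚ.≤-refl))

    -- Suppose that `first ρ` came before `first τ`. If some `u` in `τ` missed `first ρ`, then
    -- `exclusion` would give an active score for which the peak of `τ` misses it too; but this peak
    -- lies in `bottom τ` and hence in `ρ`. So `first ρ` would be common to `τ`, against minimality.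
    first-bottom : ∀ {τ ρ k l} → Common τ k → Common ρ l → bottom τ ⊆ ρ → first τ Fin.≤ first ρ
    first-bottom {τ} {ρ} τk ρl M⊆ρ = ℕₚ.≮⇒≥ λ j<k → ℕₚ.<⇒≱ j<k (first-least {τ} λ {u} u∈τ →
      decidable-stable em λ ¬Qju →
        let t , t<c , excl      = exclusion j<k (first-common {τ} τk u∈τ) ¬Qju
            v , v∈τ , sup≡      = sup-attained⁺ (f t) u∈τ
        in excl (first-common {τ} τk v∈τ) (ℕₚ.≤-pred (subst (f t u <_) sup≡ (<sup (f t) u∈τ)))
             (first-common {ρ} ρl (M⊆ρ (peak-⊆-peaks {τ = τ} t<c (∈⟪⟫⁺ (v∈τ , sup≡))))))

    sup-bottom : ∀ {τ ρ t} → bottom τ ⊆ ρ → t < c (first τ) → sup (f t) τ ≤ sup (f t) ρ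
    sup-bottom {τ} M⊆ρ t<c = sup-peak {τ = τ} (M⊆ρ ∘ peak-⊆-peaks {τ = τ} t<c)

    bottom-≡ : ∀ {τ ρ} → bottom τ ⊆ ρ → first τ ≡ first ρ →
      (∀ {t} → t < c (first τ) → sup (f t) τ ≡ sup (f t) ρ) → bottom ρ ≡ bottom τ
    bottom-≡ {τ} {ρ} M⊆ρ k≡ sup≡ =
      trans (cong (λ k → peaks (c k) ρ) (sym k≡)) (peaks-≡ (c (first τ)) M⊆ρ sup≡)

    module _ {D : ℕ} (c≤D : ∀ k → c k ≤ D) (K : Complex n)
      (common : ∀ {τ} → Face K τ → ∃ (Common τ)) (face : ∀ {τ k} → Common τ k → Face K τ) where
      open IsFoliation

      first-bottomᴷ : ∀ {τ ρ} → Face K τ → Face K ρ → bottom τ ⊆ ρ → first τ Fin.≤ first ρ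
      first-bottomᴷ τ∈K ρ∈K = first-bottom (proj₂ (common τ∈K)) (proj₂ (common ρ∈K))

      foliation : IsFoliation D bottom grade K
      foliation .bottom-⊆     {τ} _ = peaks-⊆ (c (first τ))
      foliation .bottom-small {τ} _ = ℕₚ.≤-trans (∣peaks∣≤ (c (first τ)) τ) (c≤D _)
      foliation .graded {τ} {ρ} τ∈K ρ∈K M⊆ρ
        with ℕₚ.m≤n⇒m<n∨m≡n (first-bottomᴷ τ∈K ρ∈K M⊆ρ)
      ... | inj₁ k<l = inj₁ (ℕₚ.+-mono-<-≤ k<l (∑-mono (c-mono (ℕₚ.<⇒≤ k<l)) (sup-bottom {τ} {ρ} M⊆ρ)))
      ... | inj₂ k≡l with Finₚ.toℕ-injective k≡l
      ...   | k≡l′ with ∑-strict (c (first τ)) (λ {t} → sup-bottom {τ} {ρ} {t} M⊆ρ)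
      ...     | inj₁ lt = inj₁ (subst (λ l → grade τ < toℕ l + ∑ (c l) (λ t → sup (f t) ρ)) k≡l′
                            (ℕₚ.+-monoʳ-< (toℕ (first τ)) lt))
      ...     | inj₂ eq = inj₂ (bottom-≡ {τ} {ρ} M⊆ρ k≡l′ eq)
      foliation .top {τ} τ∈K = T , T∈K , MT≡ , λ {ρ} ρ∈K M≡ {v} v∈ρ →
        let M⊆ρ = subst (_⊆ ρ) M≡ (peaks-⊆ (c (first ρ)))
            Mρ⊆τ = subst (_⊆ τ) (sym M≡) (peaks-⊆ (c (first τ)))
            k≡l = Finₚ.≤-antisym (first-bottomᴷ τ∈K ρ∈K M⊆ρ) (first-bottomᴷ ρ∈K τ∈K Mρ⊆τ)
        in ∈⟪⟫⁺ ( subst (λ k → Q k v) (sym k≡l) (first-common {ρ} (proj₂ (common ρ∈K)) v∈ρ)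
                , λ {t} t<c → ℕₚ.<-≤-trans (<sup (f t) v∈ρ)
                    (sup-bottom {ρ} {τ} Mρ⊆τ (subst (λ k → t < c k) k≡l t<c)) )
        where
        T : Subset n
        -- `T` gathers all elements through the first point of `τ` that raise no active supremum, so
        -- neither the first point nor the peaks change. A face with the same bottom has the same
        -- first point, by `first-bottomᴷ` in both directions, and no larger active suprema, so it
        -- lies in `T`.
        T = ⟪ (λ v → Q (first τ) v × (∀ {t} → t < c (first τ) → f t v < sup (f t) τ)) ⟫
        τ⊆T : τ ⊆ T
        τ⊆T v∈τ = ∈⟪⟫⁺ (first-common {τ} (proj₂ (common τ∈K)) v∈τ , λ {t} _ → <sup (f t) v∈τ)
        T-common : Common T (first τ)
        T-common v∈T = proj₁ (∈⟪⟫⁻ v∈T)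
        T∈K : Face K T
        T∈K = face {k = first τ} T-common
        M⊆T : bottom τ ⊆ T
        M⊆T v∈ = τ⊆T (peaks-⊆ (c (first τ)) v∈)
        MT≡ : bottom T ≡ bottom τ
        MT≡ = bottom-≡ {τ} {T} M⊆T
          (Finₚ.≤-antisym (first-bottomᴷ τ∈K T∈K M⊆T) (first-least {T} T-common))
          λ {t} t<c → ℕₚ.≤-antisym (sup-mono (f t) τ⊆T) (sup-lub (f t) λ v∈T → proj₂ (∈⟪⟫⁻ v∈T) t<c)

      collapsible : Collapsible D K
      collapsible = foliation⇒collapsible foliation

-- The order on ℝ

abstract
  Eventually-map₂ : ∀ {P Q R : Pred ℕ 0ℓ} → (∀ {n} → P n → Q n → R n) →
    Eventually P → Eventually Q → Eventually R
  Eventually-map₂ f (N , p) (M , q) = N ℕ.⊔ M , λ n le →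
    f (p n (ℕₚ.m⊔n≤o⇒m≤o N M le)) (q n (ℕₚ.m⊔n≤o⇒n≤o N M le))

  a-b<c⇒a<c+b : ∀ {a b c} → a ℚ.- b ℚ.< c → a ℚ.< c ℚ.+ b
  a-b<c⇒a<c+b {a} {b} {c} lt = subst (ℚ._< c ℚ.+ b) (sym (insert a b)) (ℚₚ.+-monoˡ-< b lt)

  a<c+b⇒a-b<c : ∀ {a b c} → a ℚ.< c ℚ.+ b → a ℚ.- b ℚ.< c
  a<c+b⇒a-b<c {a} {b} {c} lt = subst (a ℚ.- b ℚ.<_)
    (solve 2 (λ c b → c :+ b :- b := c) refl c b) (ℚₚ.+-monoˡ-< (ℚ.- b) lt)
    where open +-*-Solver

  0<b-a⇒a<b : ∀ {a b} → 0ℚ ℚ.< b ℚ.- a → a ℚ.< b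
  0<b-a⇒a<b {a} {b} lt = subst₂ ℚ._<_ (ℚₚ.+-identityˡ a) (sym (insert b a)) (ℚₚ.+-monoˡ-< a lt)

  p≤∣p∣ : ∀ p → p ℚ.≤ ℚ.∣ p ∣
  p≤∣p∣ p with ℚₚ.≤-total 0ℚ p
  ... | inj₁ 0≤p = ℚₚ.≤-reflexive (sym (ℚₚ.0≤p⇒∣p∣≡p 0≤p))
  ... | inj₂ p≤0 = ℚₚ.≤-trans p≤0 (ℚₚ.0≤∣p∣ p)

  p<p+ε : ∀ p {ε} → 0ℚ ℚ.< ε → p ℚ.< p ℚ.+ ε
  p<p+ε p {ε} 0<ε = subst (ℚ._< p ℚ.+ ε) (ℚₚ.+-identityʳ p) (ℚₚ.+-monoʳ-< p 0<ε)

  ∣a-b∣<ε : ∀ {a b ε} → a ℚ.< b ℚ.+ ε → b ℚ.< a ℚ.+ ε → ℚ.∣ a ℚ.- b ∣ ℚ.< ε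
  ∣a-b∣<ε {a} {b} {ε} a<b+ε b<a+ε with ℚₚ.∣p∣≡p∨∣p∣≡-p (a ℚ.- b)
  ... | inj₁ eq = subst (ℚ._< ε) (sym eq) (a<c+b⇒a-b<c (subst (a ℚ.<_) (ℚₚ.+-comm b ε) a<b+ε))
  ... | inj₂ eq = subst (ℚ._< ε) (sym (trans eq (solve 2 (λ a b → :- (a :- b) := b :- a) refl a b)))
    (a<c+b⇒a-b<c (subst (b ℚ.<_) (ℚₚ.+-comm a ε) b<a+ε))
    where open +-*-Solver

  ≤ᴿ-refl : ∀ x → x ≤ᴿ x
  ≤ᴿ-refl x ε 0<ε = 0 , λ n _ → p<p+ε (seq x n) 0<ε

  ≤ᴿ-trans : ∀ x y z → x ≤ᴿ y → y ≤ᴿ z → x ≤ᴿ z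
  ≤ᴿ-trans x y z x≤y y≤z ε 0<ε = Eventually-map₂
    (λ {n} x<y y<z → ℚₚ.<-trans x<y (subst (seq y n ℚ.+ ½ ℚ.* ε ℚ.<_)
      (trans (ℚₚ.+-assoc (seq z n) (½ ℚ.* ε) (½ ℚ.* ε)) (cong (seq z n ℚ.+_) (half+half ε)))
      (ℚₚ.+-monoˡ-< (½ ℚ.* ε) y<z)))
    (x≤y (½ ℚ.* ε) (half-pos 0<ε)) (y≤z (½ ℚ.* ε) (half-pos 0<ε))

  ≤ᴿ-antisym : ∀ x y → x ≤ᴿ y → y ≤ᴿ x → x ≃ y
  ≤ᴿ-antisym x y x≤y y≤x ε 0<ε =
    Eventually-map₂ (λ {n} → ∣a-b∣<ε {seq x n} {seq y n}) (x≤y ε 0<ε) (y≤x ε 0<ε)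

  -- Made total so that it applies termwise to sequences that are only eventually nonzero.
  inv : ℚ → ℚ
  inv q with q ℚₚ.≟ 0ℚ
  ... | yes _   = 0ℚ
  ... | no  q≢0 = ℚ.1/_ q {{ℚ.≢-nonZero q≢0}}

  inv-pos : ∀ {q} → 0ℚ ℚ.< q → 0ℚ ℚ.< inv q
  inv-pos {q} 0<q with q ℚₚ.≟ 0ℚ
  ... | yes q≡0 = contradiction (sym q≡0) (ℚₚ.<⇒≢ 0<q)
  ... | no  q≢0 = ℚₚ.positive⁻¹ _ {{ℚₚ.1/pos⇒pos q {{ℚ.positive 0<q}}}}

  inv-* : ∀ {q} → 0ℚ ℚ.< q → inv q ℚ.* q ≡ 1ℚ
  inv-* {q} 0<q with q ℚₚ.≟ 0ℚ
  ... | yes q≡0 = contradiction (sym q≡0) (ℚₚ.<⇒≢ 0<q)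
  ... | no  q≢0 = ℚₚ.*-inverseˡ q {{ℚ.≢-nonZero q≢0}}

  *-pos : ∀ {p q} → 0ℚ ℚ.< p → 0ℚ ℚ.< q → 0ℚ ℚ.< p ℚ.* q
  *-pos {p} {q} 0<p 0<q = subst (ℚ._< p ℚ.* q) (ℚₚ.*-zeroʳ p) (ℚₚ.*-monoʳ-<-pos p {{ℚ.positive 0<p}} 0<q)

  inv-≤ : ∀ {δ q} → 0ℚ ℚ.< δ → δ ℚ.≤ q → inv q ℚ.≤ inv δ
  inv-≤ {δ} {q} 0<δ δ≤q = begin
    inv q                    ≡⟨ ℚₚ.*-identityʳ (inv q) ⟨
    inv q ℚ.* 1ℚ             ≡⟨ cong (inv q ℚ.*_) (inv-* 0<δ) ⟨
    inv q ℚ.* (inv δ ℚ.* δ)  ≤⟨ ℚₚ.*-monoˡ-≤-nonNeg (inv q) {{nonNeg 0<q}}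
                                 (ℚₚ.*-monoˡ-≤-nonNeg (inv δ) {{nonNeg 0<δ}} δ≤q) ⟩
    inv q ℚ.* (inv δ ℚ.* q)  ≡⟨ solve 3 (λ i j q → i :* (j :* q) := j :* (i :* q)) refl (inv q) (inv δ) q ⟩
    inv δ ℚ.* (inv q ℚ.* q)  ≡⟨ cong (inv δ ℚ.*_) (inv-* 0<q) ⟩
    inv δ ℚ.* 1ℚ             ≡⟨ ℚₚ.*-identityʳ (inv δ) ⟩
    inv δ                    ∎
    where
    open ℚₚ.≤-Reasoning
    open +-*-Solver
    0<q : 0ℚ ℚ.< q
    0<q = ℚₚ.<-≤-trans 0<δ δ≤q
    nonNeg : ∀ {p} → 0ℚ ℚ.< p → ℚ.NonNegative (inv p)
    nonNeg 0<p = ℚ.nonNegative (ℚₚ.<⇒≤ (inv-pos 0<p))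

  inv-diff : ∀ {a b} → 0ℚ ℚ.< a → 0ℚ ℚ.< b → (inv a ℚ.* inv b) ℚ.* (b ℚ.- a) ≡ inv a ℚ.- inv b
  inv-diff {a} {b} 0<a 0<b = begin
    (inv a ℚ.* inv b) ℚ.* (b ℚ.- a)
      ≡⟨ solve 4 (λ i j a b → (i :* j) :* (b :- a) := i :* (j :* b) :- j :* (i :* a)) refl (inv a) (inv b) a b ⟩
    inv a ℚ.* (inv b ℚ.* b) ℚ.- inv b ℚ.* (inv a ℚ.* a)
      ≡⟨ cong₂ (λ p q → inv a ℚ.* p ℚ.- inv b ℚ.* q) (inv-* 0<b) (inv-* 0<a) ⟩
    inv a ℚ.* 1ℚ ℚ.- inv b ℚ.* 1ℚ
      ≡⟨ cong₂ ℚ._-_ (ℚₚ.*-identityʳ (inv a)) (ℚₚ.*-identityʳ (inv b)) ⟩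
    inv a ℚ.- inv b ∎
    where
    open ≡-Reasoning
    open +-*-Solver

  inv-cauchy : ∀ {s δ} → IsCauchy s → 0ℚ ℚ.< δ → Eventually (λ n → δ ℚ.≤ s n) → IsCauchy (inv ∘ s)
  inv-cauchy {s} {δ} cs 0<δ (N , δ≤s) ε 0<ε
    -- By `inv-diff`, terms within `η` have inverses within `inv δ * inv δ * η`. This is set to half
    -- of `ε` to leave room for the strict inequality.
    with divide-pos (*-pos (inv-pos 0<δ) (inv-pos 0<δ)) (half-pos 0<ε)
  ... | η , 0<η , ≡½ε with cs η 0<η
  ...   | M , close = N ℕ.⊔ M , λ m n le le′ →
    let δ≤sm = δ≤s m (ℕₚ.m⊔n≤o⇒m≤o N M le)
        δ≤sn = δ≤s n (ℕₚ.m⊔n≤o⇒m≤o N M le′)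
        open ℚₚ.≤-Reasoning
    in begin-strict
      ℚ.∣ inv (s m) ℚ.- inv (s n) ∣
        ≡⟨ cong ℚ.∣_∣ (inv-diff (ℚₚ.<-≤-trans 0<δ δ≤sm) (ℚₚ.<-≤-trans 0<δ δ≤sn)) ⟨
      ℚ.∣ (inv (s m) ℚ.* inv (s n)) ℚ.* (s n ℚ.- s m) ∣
        ≤⟨ ∣pq∣≤ {inv (s m) ℚ.* inv (s n)} {s n ℚ.- s m} (*-pos (inv-pos 0<δ) (inv-pos 0<δ))
             (∣pq∣≤ {inv (s m)} {inv (s n)} (inv-pos 0<δ) (bound δ≤sm) (bound δ≤sn))
             (ℚₚ.<⇒≤ (close n m (ℕₚ.m⊔n≤o⇒n≤o N M le′) (ℕₚ.m⊔n≤o⇒n≤o N M le))) ⟩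
      (inv δ ℚ.* inv δ) ℚ.* η
        ≡⟨ ≡½ε ⟩
      ½ ℚ.* ε
        <⟨ p<p+ε (½ ℚ.* ε) (half-pos 0<ε) ⟩
      ½ ℚ.* ε ℚ.+ ½ ℚ.* ε
        ≡⟨ half+half ε ⟩
      ε ∎
    where
    bound : ∀ {q} → δ ℚ.≤ q → ℚ.∣ inv q ∣ ℚ.≤ inv δ
    bound δ≤q = subst (ℚ._≤ inv δ)
      (sym (ℚₚ.0≤p⇒∣p∣≡p (ℚₚ.<⇒≤ (inv-pos (ℚₚ.<-≤-trans 0<δ δ≤q))))) (inv-≤ 0<δ δ≤q)

  -- Betweenness from convex combinations.

  module _ {S : Pred ℝ 0ℓ} (S-resp : S Respects _≃_) (S-convex : Convex S)
           {x y z : ℝ} (x∈S : x ∈ S) (z∈S : z ∈ S) (x≤y : x ≤ᴿ y) (y≤z : y ≤ᴿ z)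
           {δ : ℚ} (0<δ : 0ℚ ℚ.< δ) (gap : Eventually (λ n → δ ℚ.≤ seq z n ℚ.- seq x n))
           where

    private
      -- Solving y = t x + (1 - t) z for the weight gives t = (z - y) / (z - x), taken termwise; the
      -- gap keeps the denominators away from 0.
      i t′ : ℕ → ℚ
      i n = inv (seq z n ℚ.- seq x n)
      t′ n = (seq z n ℚ.- seq y n) ℚ.* i n

      t : ℝ
      t = mkℝ t′ (mul-cauchy {seq (z -ᴿ y)} (isCauchy (z -ᴿ y)) (inv-cauchy (isCauchy (z -ᴿ x)) 0<δ gap))

      pos : ∀ {n} → δ ℚ.≤ seq z n ℚ.- seq x n → 0ℚ ℚ.< seq z n ℚ.- seq x n
      pos = ℚₚ.<-≤-trans 0<δ

      -- An error `η` before division becomes `j * η`, at most `ε`. Used for both weights, t and 1 -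
      -- t.
      scaled : ∀ {p q η ε j} → q ℚ.< p ℚ.+ η → 0ℚ ℚ.< η → 0ℚ ℚ.< j → j ℚ.≤ inv δ → inv δ ℚ.* η ≡ ε →
        0ℚ ℚ.< (p ℚ.- q) ℚ.* j ℚ.+ ε
      scaled {p} {q} {η} {ε} {j} q<p+η 0<η 0<j j≤ eq = begin-strict
        0ℚ                               <⟨ *-pos (0<+ q<p+η) 0<j ⟩
        (p ℚ.- q ℚ.+ η) ℚ.* j            ≡⟨ solve 4 (λ p q η j → (p :- q :+ η) :* j := (p :- q) :* j :+ j :* η) refl p q η j ⟩
        (p ℚ.- q) ℚ.* j ℚ.+ j ℚ.* η      ≤⟨ ℚₚ.+-monoʳ-≤ ((p ℚ.- q) ℚ.* j)
                                              (ℚₚ.*-monoʳ-≤-nonNeg η {{ℚ.nonNegative (ℚₚ.<⇒≤ 0<η)}} j≤) ⟩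
        (p ℚ.- q) ℚ.* j ℚ.+ inv δ ℚ.* η  ≡⟨ cong ((p ℚ.- q) ℚ.* j ℚ.+_) eq ⟩
        (p ℚ.- q) ℚ.* j ℚ.+ ε            ∎
        where
        open ℚₚ.≤-Reasoning
        open +-*-Solver
        0<+ : q ℚ.< p ℚ.+ η → 0ℚ ℚ.< p ℚ.- q ℚ.+ η
        0<+ lt = subst₂ ℚ._<_ (ℚₚ.+-inverseʳ q)
          (solve 3 (λ p q η → p :+ η :- q := p :- q :+ η) refl p q η) (ℚₚ.+-monoˡ-< (ℚ.- q) lt)

      0≤t : 0ᴿ ≤ᴿ t
      0≤t ε 0<ε with divide-pos (inv-pos 0<δ) 0<ε
      ... | η , 0<η , eq = Eventually-map₂
        (λ {n} y<z+η g → scaled {seq z n} {seq y n} y<z+η 0<η (inv-pos (pos g)) (inv-≤ 0<δ g) eq) (y≤z η 0<η) gap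

      t≤1 : t ≤ᴿ 1ᴿ
      t≤1 ε 0<ε with divide-pos (inv-pos 0<δ) 0<ε
      ... | η , 0<η , eq = Eventually-map₂
        -- Here `u` is the complementary weight: `t′ n + u` is 1, so the bound reduces to 0 <
        -- `u + ε`.
        (λ {n} x<y+η g → let u = (seq y n ℚ.- seq x n) ℚ.* i n in
          subst (t′ n ℚ.<_) (begin
            t′ n ℚ.+ (u ℚ.+ ε)
              ≡⟨ solve 5 (λ z y x j ε → (z :- y) :* j :+ ((y :- x) :* j :+ ε) := j :* (z :- x) :+ ε) refl
                   (seq z n) (seq y n) (seq x n) (i n) ε ⟩
            i n ℚ.* (seq z n ℚ.- seq x n) ℚ.+ ε
              ≡⟨ cong (ℚ._+ ε) (inv-* (pos g)) ⟩
            1ℚ ℚ.+ ε ∎)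
            (p<p+ε (t′ n) (scaled {seq y n} {seq x n} x<y+η 0<η (inv-pos (pos g)) (inv-≤ 0<δ g) eq)))
        (x≤y η 0<η) gap
        where
        open ≡-Reasoning
        open +-*-Solver

      combination≃y : t *ᴿ x +ᴿ (1ᴿ -ᴿ t) *ᴿ z ≃ y
      combination≃y ε 0<ε = proj₁ gap , λ n le → let g = proj₂ gap n le in
        subst (ℚ._< ε) (sym (begin
          ℚ.∣ t′ n ℚ.* seq x n ℚ.+ (1ℚ ℚ.- t′ n) ℚ.* seq z n ℚ.- seq y n ∣
            ≡⟨ cong ℚ.∣_∣ (solve 5 (λ z y x j e → (z :- y) :* j :* x :+ (e :- (z :- y) :* j) :* z :- y
                                 := e :* z :- (z :- y) :* (j :* (z :- x)) :- y) refl
                           (seq z n) (seq y n) (seq x n) (i n) 1ℚ) ⟩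
          ℚ.∣ 1ℚ ℚ.* seq z n ℚ.- (seq z n ℚ.- seq y n) ℚ.* (i n ℚ.* (seq z n ℚ.- seq x n)) ℚ.- seq y n ∣
            ≡⟨ cong₂ (λ p q → ℚ.∣ p ℚ.- q ℚ.- seq y n ∣) (ℚₚ.*-identityˡ (seq z n))
                 (trans (cong ((seq z n ℚ.- seq y n) ℚ.*_) (inv-* (pos g))) (ℚₚ.*-identityʳ (seq z n ℚ.- seq y n))) ⟩
          ℚ.∣ seq z n ℚ.- (seq z n ℚ.- seq y n) ℚ.- seq y n ∣
            ≡⟨ cong ℚ.∣_∣ (solve 2 (λ z y → z :- (z :- y) :- y := con 0ℚ) refl (seq z n) (seq y n)) ⟩
          0ℚ ∎)) 0<ε
        where
        open ≡-Reasoning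
        open +-*-Solver

    between-apart : y ∈ S
    between-apart = S-resp combination≃y (S-convex {x} {z} {t} x∈S z∈S 0≤t t≤1)

  module _ (em : ExcludedMiddle 0ℓ) where

    -- One index beyond the Cauchy modulus for half of `ε` at which x exceeds y by `ε` forces a
    -- difference of at least half of `ε` from the modulus on.
    ≰ᴿ⇒gap : ∀ x y → ¬ x ≤ᴿ y → ∃ λ δ → 0ℚ ℚ.< δ × Eventually (λ n → δ ℚ.≤ seq x n ℚ.- seq y n)
    ≰ᴿ⇒gap x y x≰y with em {∃ λ ε → 0ℚ ℚ.< ε × ¬ Eventually (λ n → seq x n ℚ.< seq y n ℚ.+ ε)}
    ... | no none = contradiction (λ ε 0<ε → decidable-stable em λ ¬ev → none (ε , 0<ε , ¬ev)) x≰y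
    ... | yes (ε , 0<ε , ¬ev) with isCauchy (x -ᴿ y) (½ ℚ.* ε) (half-pos 0<ε)
    ...   | N , close = ½ ℚ.* ε , half-pos 0<ε , decidable-stable em λ ¬gap →
      ¬ev (N , λ n N≤n → ℚₚ.≰⇒> λ y+ε≤x → ¬gap (N , λ m N≤m →
        let w : ℕ → ℚ
            w k = seq x k ℚ.- seq y k
            ε≤w = subst (ℚ._≤ w n) (solve 2 (λ y ε → y :+ ε :- y := ε) refl (seq y n) ε)
                    (ℚₚ.+-monoˡ-≤ (ℚ.- seq y n) y+ε≤x)
            w<  = a-b<c⇒a<c+b {w n} {w m} (ℚₚ.≤-<-trans (p≤∣p∣ (w n ℚ.- w m)) (close n m N≤n N≤m))
            ½ε  = ½ ℚ.* ε
        in ℚₚ.≮⇒≥ λ wm<½ε → ℚₚ.<-irrefl refl (ℚₚ.≤-<-trans ε≤w (ℚₚ.<-trans w<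
             (subst (½ε ℚ.+ w m ℚ.<_) (half+half ε) (ℚₚ.+-monoʳ-< ½ε wm<½ε))))))
      where open +-*-Solver

    ≤ᴿ-total : ∀ x y → x ≤ᴿ y ⊎ y ≤ᴿ x
    ≤ᴿ-total x y with em {x ≤ᴿ y}
    ... | yes x≤y = inj₁ x≤y
    ... | no  x≰y with ≰ᴿ⇒gap x y x≰y
    ...   | δ , 0<δ , N , gap = inj₂ λ ε 0<ε → N , λ n N≤n →
      ℚₚ.<-trans (0<b-a⇒a<b (ℚₚ.<-≤-trans 0<δ (gap n N≤n))) (p<p+ε (seq x n) 0<ε)

    -- If `z ≤ᴿ x`, all three points coincide; otherwise the ends are apart and z - x can be
    -- inverted.
    between : ∀ {S : Pred ℝ 0ℓ} → S Respects _≃_ → Convex S →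
      ∀ {x y z} → x ∈ S → z ∈ S → x ≤ᴿ y → y ≤ᴿ z → y ∈ S
    between S-resp S-convex {x} {y} {z} x∈S z∈S x≤y y≤z with em {z ≤ᴿ x}
    ... | yes z≤x = S-resp (≤ᴿ-antisym x y x≤y (≤ᴿ-trans y z x y≤z z≤x)) x∈S
    ... | no  z≰x with ≰ᴿ⇒gap z x z≰x
    ...   | δ , 0<δ , gap = between-apart S-resp S-convex {x} {y} {z} x∈S z∈S x≤y y≤z 0<δ gap

-- Families of d-intervals

-- The last digit `toℕ u` in base `n` cannot outweigh the leading part.
lex-≤ : ∀ {n} {a b} (u v : Fin n) → a * n + toℕ u ≤ b * n + toℕ v → a ≤ b
lex-≤ {n} {a} {b} u v le = ℕₚ.≮⇒≥ λ b<a → ℕₚ.<⇒≱ (let open ℕₚ.≤-Reasoning in begin-strict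
  b * n + toℕ v   <⟨ ℕₚ.+-monoʳ-< (b * n) (Finₚ.toℕ<n v) ⟩
  b * n + n       ≡⟨ ℕₚ.+-comm (b * n) n ⟩
  suc b * n       ≤⟨ ℕₚ.*-monoˡ-≤ n b<a ⟩
  a * n           ≤⟨ ℕₚ.m≤m+n (a * n) (toℕ u) ⟩
  a * n + toℕ u   ∎) le

lex-injective : ∀ {n} (g : Fin n → ℕ) → Injective _≡_ _≡_ (λ v → g v * n + toℕ v)
lex-injective {n} g {u} {v} eq = Finₚ.toℕ-injective (ℕₚ.+-cancelˡ-≡ (g v * n) _ _
  (subst (λ a → a * n + toℕ u ≡ g v * n + toℕ v) g≡ eq))
  where
  g≡ : g u ≡ g v
  g≡ = ℕₚ.≤-antisym (lex-≤ u v (ℕₚ.≤-reflexive eq)) (lex-≤ v u (ℕₚ.≤-reflexive (sym eq)))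

-- The lexicographic order on pairs of level and position.

module _ {d m : ℕ} where

  remQuot₁-mono : ∀ {j k : Fin (d * m)} → j Fin.≤ k →
    proj₁ (remQuot {d} m j) Fin.≤ proj₁ (remQuot {d} m k)
  remQuot₁-mono {j} {k} j≤k = ℕₚ.≮⇒≥ λ lt → ℕₚ.<⇒≱
    (subst₂ Fin._<_ (Finₚ.combine-remQuot {d} m k) (Finₚ.combine-remQuot {d} m j)
      (Finₚ.combine-monoˡ-< (proj₂ (remQuot {d} m k)) (proj₂ (remQuot {d} m j)) lt)) j≤k

  remQuot₂-strict : ∀ {j k : Fin (d * m)} → j Fin.< k → proj₁ (remQuot {d} m j) ≡ proj₁ (remQuot {d} m k) →
    proj₂ (remQuot {d} m j) Fin.< proj₂ (remQuot {d} m k)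
  remQuot₂-strict {j} {k} j<k i≡ = ℕₚ.+-cancelˡ-< (m * toℕ i) _ _ (subst₂ _<_
    (trans (cong toℕ (sym (Finₚ.combine-remQuot {d} m j))) (Finₚ.toℕ-combine i b))
    (trans (cong toℕ (sym (Finₚ.combine-remQuot {d} m k)))
      (trans (Finₚ.toℕ-combine ℓ a) (cong (λ i → m * toℕ i + toℕ a) (sym i≡)))) j<k)
    where
    i ℓ : Fin d
    i = proj₁ (remQuot {d} m j)
    ℓ = proj₁ (remQuot {d} m k)
    b a : Fin m
    b = proj₂ (remQuot {d} m j)
    a = proj₂ (remQuot {d} m k)

-- The grid of witnesses and the extremal scores of a family.

module _ (em : ExcludedMiddle 0ℓ) where
  open Classical em

  ≤ᴿ-decTotalOrder : DecTotalOrder 0ℓ 0ℓ 0ℓ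
  ≤ᴿ-decTotalOrder = record
    { Carrier = ℝ
    ; _≈_ = λ x y → x ≤ᴿ y × y ≤ᴿ x
    ; _≤_ = _≤ᴿ_
    ; isDecTotalOrder = record
      { isTotalOrder = record
        { isPartialOrder = record
          { isPreorder = record
            { isEquivalence = record
              { refl  = λ {x} → ≤ᴿ-refl x , ≤ᴿ-refl x
              ; sym   = swap
              ; trans = λ {x} {y} {z} (x≤y , y≤x) (y≤z , z≤y) →
                  ≤ᴿ-trans x y z x≤y y≤z , ≤ᴿ-trans z y x z≤y y≤x
              }
            ; reflexive = proj₁
            ; trans     = λ {x} {y} {z} → ≤ᴿ-trans x y z
            }
          ; antisym = _,_
          }
        ; total = ≤ᴿ-total em
        }
      ; _≟_  = λ _ _ → em
      ; _≤?_ = λ _ _ → em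
      }
    }

  open DecTotalOrder ≤ᴿ-decTotalOrder using (totalOrder)
  open Sort ≤ᴿ-decTotalOrder using (sort; sort-↭; sort-↗)

  𝒞≡-between : ∀ {d} {P C : Pred (Point d) 0ℓ} → C ∈ 𝒞≡ P → ∀ {i x y z} →
    (x , i) ∈ C → (z , i) ∈ C → x ≤ᴿ y → y ≤ᴿ z → (y , i) ∈ P → (y , i) ∈ C
  𝒞≡-between (I , isD , C⊆ , ⊆C) {i} {x} {y} {z} x∈C z∈C x≤y y≤z y∈P = ⊆C
    (proj₂ decomposes (between em {level i} (λ {x} {y} → level-resp i {x} {y}) (level-convex i) {x} {y} {z}
      (proj₁ decomposes (proj₁ (C⊆ x∈C))) (proj₁ decomposes (proj₁ (C⊆ z∈C))) x≤y y≤z) , y∈P)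
    where open IsDInterval isD

  module _ {d : ℕ} (1≤d : 1 ≤ d) (P : Pred (Point d) 0ℓ)
           {n : ℕ} (C : Fin n → Pred (Point d) 0ℓ) (C∈𝒞≡ : ∀ v → C v ∈ 𝒞≡ P) where

    -- One point for each face suffices to determine the nerve. Non-faces get a default point, whose
    -- level comes from `1≤d`.
    witness : Subset n → Point d
    witness τ with em {Face (nerve C) τ}
    ... | yes (p , _) = p
    ... | no  _       = 0ᴿ , fromℕ< 1≤d

    witness-∈ : ∀ {τ} → Face (nerve C) τ → ∀ {v} → v ∈ˢ τ → witness τ ∈ C v
    witness-∈ {τ} τ∈K {v} v∈τ with em {Face (nerve C) τ}
    ... | yes (_ , p∈) = p∈ (v , v∈τ)
    ... | no  τ∉K      = contradiction τ∈K τ∉K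

    -- The same x-coordinates are used on all levels, so not every point
    -- of the resulting grid lies in P.
    coordinates : List ℝ
    coordinates = sort (map (proj₁ ∘ witness) (subsets n))

    m : ℕ
    m = length coordinates

    -- Coordinates may repeat, so the scores compare positions rather than real numbers.
    x : Fin m → ℝ
    x = lookup coordinates

    x-mono : ∀ {a b} → a Fin.≤ b → x a ≤ᴿ x b
    x-mono {a} {b} = lookup-mono-≤ totalOrder (sort-↗ (map (proj₁ ∘ witness) (subsets n))) {a} {b}

    coordinate-∈ : ∀ τ → proj₁ (witness τ) ∈ᴸ coordinates
    coordinate-∈ τ = ∈-resp-↭ (↭-sym (sort-↭ (map (proj₁ ∘ witness) (subsets n))))
      (∈-map⁺ (proj₁ ∘ witness) (∈-subsets τ))

    point : Fin d × Fin m → Point d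
    point (i , a) = x a , i

    level : Fin (d * m) → Fin d
    level k = proj₁ (remQuot {d} m k)

    position : Fin (d * m) → Fin m
    position k = proj₂ (remQuot {d} m k)

    Q : Fin (d * m) → Pred (Fin n) 0ℓ
    Q k v = point (remQuot {d} m k) ∈ C v

    stage : Subset n → Fin (d * m)
    stage τ = combine (proj₂ (witness τ)) (index (coordinate-∈ τ))

    stage-witness : ∀ τ → point (remQuot {d} m (stage τ)) ≡ witness τ
    stage-witness τ = trans
      (cong point (Finₚ.remQuot-combine (proj₂ (witness τ)) (index (coordinate-∈ τ))))
      (cong (_, proj₂ (witness τ)) (sym (lookup-index (coordinate-∈ τ))))

    -- Each earlier level contributes its left and right scores, the level of `k` only the left one.
    -- Levels count from 0, so the maximum is 2(d - 1) + 1.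
    active : Fin (d * m) → ℕ
    active k = suc (2 * toℕ (level k))

    active-mono : ∀ {j k} → j Fin.≤ k → active j ≤ active k
    active-mono j≤k = s≤s (ℕₚ.*-monoʳ-≤ 2 (remQuot₁-mono {d} {m} j≤k))

    active≤2d∸1 : ∀ k → active k ≤ 2 * d ∸ 1
    active≤2d∸1 k = subst (_≤ 2 * d ∸ 1) (ℕₚ.+-suc l (l + 0))
      (ℕₚ.∸-monoˡ-≤ 1 (ℕₚ.*-monoʳ-≤ 2 (Finₚ.toℕ<n (level k))))
      where
      l : ℕ
      l = toℕ (level k)

    -- The score 2i counts the points to the left of a set on level i, and the
    -- score 2i + 1 those to its right; both count all points if the level is empty.
    OnSide : ℕ → Fin n → Pred (Fin m) 0ℓ
    OnSide t v a = ∀ i b → (x b , i) ∈ C v →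
      (t ≡ 2 * toℕ i → a Fin.< b) × (t ≡ suc (2 * toℕ i) → b Fin.< a)

    -- The count leads and the index breaks ties, which makes the score injective. On a level that
    -- they meet, the sets starting last lead on the left and those ending first on the right.
    f : ℕ → Fin n → ℕ
    f t v = ∣ ⟪ OnSide t v ⟫ ∣ * n + toℕ v

    -- The condition for the right side is vacuous by parity.
    onLeft : ∀ i {a v} → (∀ b → (x b , i) ∈ C v → a Fin.< b) → OnSide (2 * toℕ i) v a
    onLeft i {a} {v} before i′ b b∈ =
      (λ eq → before b (subst (λ i → (x b , i) ∈ C v) (sym (Finₚ.toℕ-injective (ℕₚ.*-cancelˡ-≡ _ _ 2 eq))) b∈))
      , λ eq → contradiction eq (ℕₚ.even≢odd (toℕ i) (toℕ i′))

    onRight : ∀ i {a v} → (∀ b → (x b , i) ∈ C v → b Fin.< a) → OnSide (suc (2 * toℕ i)) v a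
    onRight i {a} {v} after i′ b b∈ =
      (λ eq → contradiction (sym eq) (ℕₚ.even≢odd (toℕ i′) (toℕ i)))
      , λ eq → after b (subst (λ i → (x b , i) ∈ C v)
          (sym (Finₚ.toℕ-injective (ℕₚ.*-cancelˡ-≡ _ _ 2 (ℕₚ.suc-injective eq)))) b∈)

    onLeft⁻ : ∀ i {a v} → OnSide (2 * toℕ i) v a → ∀ b → (x b , i) ∈ C v → a Fin.< b
    onLeft⁻ i side b b∈ = proj₁ (side i b b∈) refl

    onRight⁻ : ∀ i {a v} → OnSide (suc (2 * toℕ i)) v a → ∀ b → (x b , i) ∈ C v → b Fin.< a
    onRight⁻ i side b b∈ = proj₂ (side i b b∈) refl

    -- The hypothesis `chain` makes the two sets of counted points comparable by inclusion, so the
    -- counts decide which contains the other.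
    OnSide-mono : ∀ {t u v} → (∀ {a b} → OnSide t u a → OnSide t v b → OnSide t v a ⊎ OnSide t u b) →
      f t u ≤ f t v → ∀ {a} → OnSide t u a → OnSide t v a
    OnSide-mono {t} {u} {v} chain fu≤fv {a} =
      ∈⟪⟫⁻ ∘ chain-≤⇒⊆ ⟪ OnSide t u ⟫ ⟪ OnSide t v ⟫ ⊆⊎⊇ (lex-≤ u v fu≤fv) ∘ ∈⟪⟫⁺
      where
      ⊆⊎⊇ : ⟪ OnSide t u ⟫ ⊆ ⟪ OnSide t v ⟫ ⊎ ⟪ OnSide t v ⟫ ⊆ ⟪ OnSide t u ⟫
      ⊆⊎⊇ with em {∃ λ a → OnSide t u a × ¬ OnSide t v a}
      ... | no none = inj₁ λ {b} b∈ → ∈⟪⟫⁺ (decide (∈⟪⟫⁻ b∈))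
        where
        decide : ∀ {b} → OnSide t u b → OnSide t v b
        decide {b} ub with em {OnSide t v b}
        ... | yes vb = vb
        ... | no ¬vb = contradiction (b , ub , ¬vb) none
      ... | yes (a , ua , ¬va) = inj₂ λ {b} b∈ → ∈⟪⟫⁺ (other (chain ua (∈⟪⟫⁻ b∈)))
        where
        other : ∀ {b} → OnSide t v a ⊎ OnSide t u b → OnSide t u b
        other (inj₁ va) = contradiction va ¬va
        other (inj₂ ub) = ub

    -- Positions to the left are closed downwards, so the lesser of `a` and `b` is to the left of
    -- both sets. On the right the greater one plays this role.
    onLeft-mono : ∀ i {u v a} → f (2 * toℕ i) u ≤ f (2 * toℕ i) v →
      OnSide (2 * toℕ i) u a → OnSide (2 * toℕ i) v a
    onLeft-mono i {u} {v} fu≤fv = OnSide-mono {u = u} {v} chain fu≤fv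
      where
      chain : ∀ {a b} → OnSide (2 * toℕ i) u a → OnSide (2 * toℕ i) v b →
        OnSide (2 * toℕ i) v a ⊎ OnSide (2 * toℕ i) u b
      chain {a} {b} ua vb with ℕₚ.≤-total (toℕ a) (toℕ b)
      ... | inj₁ a≤b = inj₁ (onLeft i λ e e∈ → ℕₚ.≤-<-trans a≤b (onLeft⁻ i vb e e∈))
      ... | inj₂ b≤a = inj₂ (onLeft i λ e e∈ → ℕₚ.≤-<-trans b≤a (onLeft⁻ i ua e e∈))

    onRight-mono : ∀ i {u v a} → f (suc (2 * toℕ i)) u ≤ f (suc (2 * toℕ i)) v →
      OnSide (suc (2 * toℕ i)) u a → OnSide (suc (2 * toℕ i)) v a
    onRight-mono i {u} {v} fu≤fv = OnSide-mono {u = u} {v} chain fu≤fv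
      where
      chain : ∀ {a b} → OnSide (suc (2 * toℕ i)) u a → OnSide (suc (2 * toℕ i)) v b →
        OnSide (suc (2 * toℕ i)) v a ⊎ OnSide (suc (2 * toℕ i)) u b
      chain {a} {b} ua vb with ℕₚ.≤-total (toℕ a) (toℕ b)
      ... | inj₁ a≤b = inj₂ (onRight i λ e e∈ → ℕₚ.<-≤-trans (onRight⁻ i ua e e∈) a≤b)
      ... | inj₂ b≤a = inj₁ (onRight i λ e e∈ → ℕₚ.<-≤-trans (onRight⁻ i vb e e∈) b≤a)

    -- By convexity, a set that misses a grid point of `P` lies on one side of it on that level. Any
    -- set with at least the same score for this side then misses the point as well.
    exclusion : ∀ {j k u} → j Fin.< k → Q k u → ¬ Q j u →
      ∃ λ t → t < active k × (∀ {v} → Q k v → f t u ≤ f t v → ¬ Q j v)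
    exclusion {j} {k} {u} j<k Qku ¬Qju with em {point (remQuot {d} m j) ∈ P}
    -- No set of the family contains a point outside `P`, so any active score serves, and 0 is
    -- always active.
    ... | no j∉P = 0 , s≤s z≤n , λ {v} _ _ Qjv →
      contradiction (proj₂ (proj₁ (proj₂ (proj₂ (C∈𝒞≡ v))) Qjv)) j∉P
    ... | yes j∈P with em {∃ λ b → (x b , level j) ∈ C u × b Fin.≤ position j}
    ...   | no none = 2 * toℕ (level j)
      , s≤s (ℕₚ.*-monoʳ-≤ 2 (remQuot₁-mono {d} {m} (ℕₚ.<⇒≤ j<k)))
      , λ {v} _ fu≤fv Qjv → ℕₚ.<-irrefl refl (onLeft⁻ (level j) {v = v}
          (onLeft-mono (level j) {u} {v} fu≤fv (onLeft (level j) {v = u} λ b b∈ → ℕₚ.≰⇒> λ b≤ → none (b , b∈ , b≤)))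
          (position j) Qjv)
    -- Since `u` has a point at or before position `j`, it must end before it. On the level of `k`
    -- this is impossible, as `u` contains the later point `k`; so `j` is on an earlier level, where
    -- the right score is active.
    ...   | yes (b , b∈ , b≤) = suc (2 * toℕ (level j))
      , s≤s (ℕₚ.*-monoʳ-< 2 (ℕₚ.≤∧≢⇒< (remQuot₁-mono {d} {m} (ℕₚ.<⇒≤ j<k)) levels≢))
      , λ {v} _ fu≤fv Qjv → ℕₚ.<-irrefl refl (onRight⁻ (level j) {v = v}
          (onRight-mono (level j) {u} {v} fu≤fv (onRight (level j) {v = u} after)) (position j) Qjv)
      where
      after : ∀ e → (x e , level j) ∈ C u → e Fin.< position j
      after e e∈ = ℕₚ.≰⇒> λ ≤e → ¬Qju (𝒞≡-between (C∈𝒞≡ u) b∈ e∈ (x-mono b≤) (x-mono ≤e) j∈P)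
      levels≢ : toℕ (level j) ≢ toℕ (level k)
      levels≢ eq = ℕₚ.<-asym (remQuot₂-strict {d} {m} j<k (Finₚ.toℕ-injective eq))
        (after (position k) (subst (λ i → (x (position k) , i) ∈ C u) (sym (Finₚ.toℕ-injective eq)) Qku))

    -- Even the empty set has a witness, which supplies the default index.
    open Staged (stage ⊥) Q active active-mono f (λ t → lex-injective (λ v → ∣ ⟪ OnSide t v ⟫ ∣)) exclusion

    nerve-collapsible : Collapsible (2 * d ∸ 1) (nerve C)
    nerve-collapsible = collapsible active≤2d∸1 (nerve C)
      (λ {τ} τ∈K → stage τ , λ {v} v∈τ → subst (_∈ C v) (sym (stage-witness τ)) (witness-∈ τ∈K v∈τ))
      (λ {τ} {k} common → point (remQuot {d} m k) , λ (v , v∈τ) → common v∈τ)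

theorem3 : ExcludedMiddle 0ℓ →
    (d : ℕ) → 1 ≤ d →
    (P : Pred (Point d) 0ℓ) → P Respects _≋_ →
    (n : ℕ) (C : Fin n → Pred (Point d) 0ℓ) → (∀ j → C j ∈ 𝒞≡ P) →
    Collapsible (2 * d ∸ 1) (nerve C)
theorem3 em d 1≤d P _ n C C∈𝒞≡ = nerve-collapsible em 1≤d P C C∈𝒞≡
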